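{- Let $\pi$ be an $\mathbb F_q$-subplane of the transversal plane $\Gamma$ (equivalently, let $\bar\pi$ be an $\mathbb F_q$-subplane of $\mathrm{PG}(2,q^3)$ in the Bose representation). Then in $\mathrm{PG}(8,q)$ the planes $\{[X] : X\in\pi\}$ form one system of maximal spaces of a Segre variety $\mathcal S_{2;2}$.
   Context: $q$ is a prime power; $\mathrm{PG}(8,q)\subset\mathrm{PG}(8,q^3)$; for a point $X=(x_0,\dots,x_8)$, $X^q=(x_0^q,\dots,x_8^q)$ and $\Sigma^q=\{X^q:X\in\Sigma\}$ for a subspace $\Sigma$. Let $\Gamma$ be a plane of $\mathrm{PG}(8,q^3)$ disjoint from $\mathrm{PG}(8,q)$ such that $\Gamma,\Gamma^q,\Gamma^{q^2}$ span $\mathrm{PG}(8,q^3)$. For $X\in\Gamma$, $[X]=\langle X,X^q,X^{q^2}\rangle\cap\mathrm{PG}(8,q)$ is a plane, and these planes form a regular $2$-spread of $\mathrm{PG}(8,q)$; the Bose representation identifies points of $\mathrm{PG}(2,q^3)$ with points of $\Gamma\cong\mathrm{PG}(2,q^3)$ and with spread planes $[X]$. An $\mathbb F_q$-subplane is a subplane projectively equivalent to $\mathrm{PG}(2,q)$. A Segre variety $\mathcal S_{2;2}$ of $\mathrm{PG}(8,q)$ is (up to projectivity) the image of $\mathrm{PG}(2,q)\times\mathrm{PG}(2,q)$ under the Segre map $((x_i),(y_j))\mapsto(x_iy_j)$; it has two systems of maximal subspaces (planes). -}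

module Defs where

open import Level using (Level; _⊔_)
open import Data.Nat as ℕ using (ℕ; zero; suc)
open import Data.Nat.Primality using (Prime)
open import Data.Fin using (Fin; zero; suc; remQuot)
open import Data.Product using (Σ; ∃; _×_; _,_; proj₁; proj₂)
open import Relation.Nullary using (¬_)
open import Relation.Binary.PropositionalEquality as ≡ using (_≡_)
open import Function.Bundles using (Inverse; _⇔_)
open import Algebra.Bundles using (CommutativeRing)
import Data.Fin
import Algebra.Bundles
import Data.Sum
import Relation.Nullary

IsPrimePower : ℕ → Set
IsPrimePower q = Σ ℕ λ p → Σ ℕ λ k → Prime p × q ≡ p ℕ.^ suc k

IsField : ∀ {c ℓ} → CommutativeRing c ℓ → Set (c ⊔ ℓ)
IsField R = ¬ (1# ≈ 0#) × (∀ x → ¬ (x ≈ 0#) → Σ Carrier λ y → x * y ≈ 1#)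
  where open CommutativeRing R

HasCard : ∀ {c ℓ} → CommutativeRing c ℓ → ℕ → Set (c ⊔ ℓ)
HasCard R n = Inverse (CommutativeRing.setoid R) (≡.setoid (Fin n))

-- Projective geometry over the field K = Carrier R, with K ⊇ F_q where
-- F_q = { a | a ^ q ≈ a } (K is meant to be GF(q^3)).
-- Points of PG(n-1,K) are represented by nonzero vectors  Fin n → K ;
-- all point-sets below are predicates on vectors closed under K-scalars.
module Geometry {c ℓ} (R : CommutativeRing c ℓ) (q : ℕ) where
  open CommutativeRing R hiding (zero)
  open import Algebra.Definitions.RawSemiring (Algebra.Bundles.Semiring.rawSemiring semiring) using (_^_)

  K : Set c
  K = Carrier

  Vect : ℕ → Set c
  Vect n = Fin n → K

  frob : K → K
  frob x = x ^ q

  frobV : ∀ {n} → Vect n → Vect n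
  frobV v k = frob (v k)

  frobV^ : ∀ {n} → ℕ → Vect n → Vect n
  frobV^ zero    v = v
  frobV^ (suc j) v = frobV (frobV^ j v)

  InFq : K → Set ℓ
  InFq a = frob a ≈ a

  FqVect : ∀ {n} → Vect n → Set ℓ
  FqVect v = ∀ k → InFq (v k)

  NonzeroV : ∀ {n} → Vect n → Set ℓ
  NonzeroV v = Σ _ λ k → ¬ (v k ≈ 0#)

  sumF : ∀ m → (Fin m → K) → K
  sumF zero    f = 0#
  sumF (suc m) f = f zero + sumF m (λ i → f (suc i))

  lincomb : ∀ {m n} → (Fin m → K) → (Fin m → Vect n) → Vect n
  lincomb {m} cs vs k = sumF m (λ i → cs i * vs i k)

  InSpan : ∀ {m n} → (Fin m → Vect n) → Vect n → Set (c ⊔ ℓ)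
  InSpan {m} {n} vs v = Σ (Fin m → K) λ cs → ∀ k → v k ≈ lincomb cs vs k

  LinIndep : ∀ {m n} → (Fin m → Vect n) → Set (c ⊔ ℓ)
  LinIndep {m} vs = ∀ (cs : Fin m → K) → (∀ k → lincomb cs vs k ≈ 0#) → ∀ i → cs i ≈ 0#

  -- v represents a point of PG(n-1,q) ⊂ PG(n-1,q^3)
  RationalPt : ∀ {n} → Vect n → Set (c ⊔ ℓ)
  RationalPt v = NonzeroV v × Σ K λ s → Σ (Vect _) λ w → FqVect w × (∀ k → v k ≈ s * w k)

  TransversalPlane : (Fin 3 → Vect 9) → Set (c ⊔ ℓ)
  TransversalPlane g =
    LinIndep g
    × (∀ v → InSpan g v → ¬ RationalPt v)
    × (∀ v → InSpan (λ (t : Fin (3 ℕ.* 3)) →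
                       frobV^ (Data.Fin.toℕ (proj₁ (remQuot {3} 3 t))) (g (proj₂ (remQuot {3} 3 t)))) v)

  -- h is a basis of Γ = ⟨g⟩; the F_q-subplane π determined by h is
  -- { ⟨Σ a_i h_i⟩ : a ∈ F_q^3 \ 0 } (the image of PG(2,q) under a
  -- projectivity of Γ ≅ PG(2,q^3)).
  BasisOf : (Fin 3 → Vect 9) → (Fin 3 → Vect 9) → Set (c ⊔ ℓ)
  BasisOf g h = (∀ i → InSpan g (h i)) × LinIndep h

  ptOf : (Fin 3 → Vect 9) → Vect 3 → Vect 9
  ptOf h a = lincomb a h

  -- the spread plane [X] = ⟨X, X^q, X^{q^2}⟩ ∩ PG(8,q), as a set of points
  Bracket : Vect 9 → Vect 9 → Set (c ⊔ ℓ)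
  Bracket x v = RationalPt v × InSpan (λ (j : Fin 3) → frobV^ (Data.Fin.toℕ j) x) v

  segre : Vect 3 → Vect 3 → Vect 9
  segre x y t = x (proj₁ (remQuot {3} 3 t)) * y (proj₂ (remQuot {3} 3 t))

  Matrix : Set c
  Matrix = Fin 9 → Fin 9 → K

  applyM : Matrix → Vect 9 → Vect 9
  applyM M v i = sumF 9 (λ j → M i j * v j)

  mulM : Matrix → Matrix → Matrix
  mulM M N i k = sumF 9 (λ j → M i j * N j k)

  idM : Matrix
  idM i k with i Data.Fin.≟ k
  ... | Relation.Nullary.yes _ = 1#
  ... | Relation.Nullary.no _  = 0#

  FqProjectivity : Matrix → Set (c ⊔ ℓ)
  FqProjectivity M =
    (∀ i j → InFq (M i j))
    × Σ Matrix λ N → (∀ i j → InFq (N i j))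
        × (∀ i k → mulM M N i k ≈ idM i k) × (∀ i k → mulM N M i k ≈ idM i k)

  -- maximal planes of the Segre variety M(S_{2;2}):
  -- first system: for fixed y, { M(x ⊗ y) : x ∈ PG(2,q) }
  SegrePlane₁ : Matrix → Vect 3 → Vect 9 → Set (c ⊔ ℓ)
  SegrePlane₁ M y v = NonzeroV v × Σ K λ s → Σ (Vect 3) λ x →
                        FqVect x × (∀ k → v k ≈ s * applyM M (segre x y) k)
  SegrePlane₂ : Matrix → Vect 3 → Vect 9 → Set (c ⊔ ℓ)
  SegrePlane₂ M x v = NonzeroV v × Σ K λ s → Σ (Vect 3) λ y →
                        FqVect y × (∀ k → v k ≈ s * applyM M (segre x y) k)

  SameFamily : (Fin 3 → Vect 9) → (Vect 3 → Vect 9 → Set (c ⊔ ℓ)) → Set (c ⊔ ℓ)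
  SameFamily h P =
    (∀ a → FqVect a → NonzeroV a →
       Σ (Vect 3) λ y → FqVect y × NonzeroV y × (∀ v → Bracket (ptOf h a) v ⇔ P y v))
    × (∀ y → FqVect y → NonzeroV y →
       Σ (Vect 3) λ a → FqVect a × NonzeroV a × (∀ v → Bracket (ptOf h a) v ⇔ P y v))

  OneSystemOfSegre : (Fin 3 → Vect 9) → Set (c ⊔ ℓ)
  OneSystemOfSegre h = Σ Matrix λ M → FqProjectivity M
    × (SameFamily h (SegrePlane₁ M) Data.Sum.⊎ SameFamily h (SegrePlane₂ M))

-- Write X = Σ aᵢ hᵢ with a over F_q. The vectors of PG(8,q) in ⟨X, X^q, X^{q²}⟩
-- are, up to scalars, the traces Tr(x X), x ∈ K = GF(q³): X, X^q, X^{q²} are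
-- independent, so a combination of them fixed by Frobenius has conjugate
-- coefficients. If e₀, e₁, e₂ is an F_q-basis of K and x = Σ bⱼ eⱼ with b over
-- F_q, then Tr(x X) = Σ aᵢ bⱼ Tr(eⱼ hᵢ) = M (a ⊗ b), where M has columns
-- Tr(eⱼ hᵢ). The matrix M is over F_q, and it is invertible because it is the
-- product of the matrix of the nine conjugates hᵢ^{q^t}, which span K⁹, with
-- copies of the Moore matrix (eⱼ^{q^t}). Since K is finite, the usual dimension
-- arguments reduce to the pigeonhole principle on Kⁿ.

module Submission where

open import Defs
open import Data.Nat as ℕ using (ℕ; zero; suc; _^_; _!; _∸_; s≤s)
open import Data.Nat.Combinatorics using (_C_; nCk≡n!/k![n-k]!; k![n∸k]!∣n!; nCn≡1; nCk≡nC[n∸k])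
open import Data.Nat.Divisibility using (_∣_; divides; ∣⇒≤; m∣m*n)
open import Data.Nat.DivMod using (m/n*n≡m)
open import Data.Nat.Primality using (Prime; euclidsLemma; prime⇒nonTrivial; prime⇒nonZero)
import Data.Nat.Properties as ℕ
open import Data.Fin as Fin using (Fin; zero; suc; toℕ; fromℕ; inject₁; combine; remQuot; _↑ˡ_; _↑ʳ_)
import Data.Fin.Properties as Fin
open import Data.Fin.Permutation using (Permutation; permutation)
open import Data.Product using (Σ; ∃; _×_; _,_; proj₁; proj₂)
open import Data.Sum using (inj₁; inj₂)
open import Data.Vec.Functional using (_∷_; removeAt)
open import Function using (_∘_)
open import Function.Bundles using (Inverse; mk⇔; _⇔_)
open import Algebra.Bundles using (CommutativeRing)
open import Relation.Nullary using (¬_; Dec; yes; no; contradiction)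
open import Relation.Binary.PropositionalEquality as ≡ using (_≡_; _≢_)

-- Factorials and binomial coefficients modulo a prime.

prime∤! : ∀ {p} → Prime p → ∀ k → k ℕ.< p → ¬ p ∣ k !
prime∤! {p} pr zero    _   p∣1 =
  ℕ.<⇒≱ (ℕ.nonTrivial⇒n>1 p {{prime⇒nonTrivial pr}}) (∣⇒≤ p∣1)
prime∤! pr (suc k) k<p p∣k! with euclidsLemma (suc k) (k !) pr p∣k!
... | inj₁ p∣1+k = ℕ.<⇒≱ k<p (∣⇒≤ p∣1+k)
... | inj₂ p∣k!  = prime∤! pr k (ℕ.<-trans (ℕ.n<1+n k) k<p) p∣k!

n∣n! : ∀ n .{{_ : ℕ.NonZero n}} → n ∣ n !
n∣n! (suc n) = m∣m*n (n !)

-- The prime p divides p! = C(p,k) k! (p-k)!, but neither factorial on the right, since k and p-k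
-- are both below p. Euclid's lemma leaves only the binomial coefficient.
prime∣binomial : ∀ {p} → Prime p → ∀ k → 0 ℕ.< k → k ℕ.< p → p ∣ p C k
prime∣binomial {p} pr k 0<k k<p
  with euclidsLemma (p C k) (k ! ℕ.* (p ∸ k) !) pr
         (≡.subst (p ∣_) (≡.sym C*k![p-k]!≡p!) (n∣n! p {{prime⇒nonZero pr}}))
  where
  instance _ = k ℕ.!* (p ∸ k) !≢0
  C*k![p-k]!≡p! : (p C k) ℕ.* (k ! ℕ.* (p ∸ k) !) ≡ p !
  C*k![p-k]!≡p! = ≡.trans
    (≡.cong (ℕ._* (k ! ℕ.* (p ∸ k) !)) (nCk≡n!/k![n-k]! (ℕ.<⇒≤ k<p)))
    (m/n*n≡m (k![n∸k]!∣n! (ℕ.<⇒≤ k<p)))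
... | inj₁ p∣C = p∣C
... | inj₂ p∣k![p-k]! with euclidsLemma (k !) ((p ∸ k) !) pr p∣k![p-k]!
...   | inj₁ p∣k!     = contradiction p∣k! (prime∤! pr k k<p)
...   | inj₂ p∣[p-k]! = contradiction p∣[p-k]!
          (prime∤! pr (p ∸ k) (ℕ.∸-monoʳ-< 0<k (ℕ.<⇒≤ k<p)))

-- The pigeonhole principle on finite sets.

-- If k were missed, punching k out of the codomain would inject `suc n` elements into n.
injective⇒surjective : ∀ {n} (f : Fin n → Fin n) → (∀ {i j} → f i ≡ f j → i ≡ j) →
                       ∀ k → ∃ λ i → f i ≡ k
injective⇒surjective {suc n} f inj k with Fin.any? (λ i → f i Fin.≟ k)
... | yes hit  = hit
... | no  miss = contradiction
  (Fin.injective⇒≤ {f = λ i → Fin.punchOut (λ k≡fi → miss (i , ≡.sym k≡fi))}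
    (λ {i} {j} eq → inj (Fin.punchOut-injective
      (λ k≡fi → miss (i , ≡.sym k≡fi)) (λ k≡fj → miss (j , ≡.sym k≡fj)) eq)))
  ℕ.1+n≰n

-- Finite fields: sums and products over all elements.

module FiniteField {c ℓ} (R : CommutativeRing c ℓ) (isField : IsField R)
                   {N : ℕ} (card : HasCard R N) where
  open CommutativeRing R hiding (zero)
  open Inverse card using (to; from; to-cong; strictlyInverseˡ; strictlyInverseʳ)
  open import Algebra.Properties.Semiring.Mult semiring
    using (×-congʳ; ×-congˡ; ×-assocˡ; ×-assoc-*; ×1-homo-*; ×-homo-1) renaming (_×_ to _·_)
  open import Algebra.Properties.CommutativeSemiring.Exp commutativeSemiring
    using (^-congˡ; ^-congʳ; ^-assocʳ) renaming (_^_ to _^ᴷ_)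
  open import Algebra.Properties.CommutativeSemiring.Binomial commutativeSemiring as Binomial
    using (binomialTerm)
  import Algebra.Properties.CommutativeMonoid.Sum as MonoidSum
  open import Algebra.Properties.Group +-group using (identityʳ-unique)
  open import Relation.Binary.Reasoning.Setoid setoid
  private
    module Sum = MonoidSum +-commutativeMonoid
    module Product = MonoidSum *-commutativeMonoid

  -- Case splits on vanishing and searches for a nonvanishing coordinate use this; the enumeration
  -- reduces equality in the field to equality of indices.
  _≈?_ : ∀ x y → Dec (x ≈ y)
  x ≈? y with to x Fin.≟ to y
  ... | yes eq = yes (begin
    x           ≈⟨ strictlyInverseʳ x ⟨
    from (to x) ≡⟨ ≡.cong from eq ⟩
    from (to y) ≈⟨ strictlyInverseʳ y ⟩
    y           ∎)
  ... | no neq = no (λ x≈y → neq (to-cong x≈y))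

  *-cancelˡ-nonzero : ∀ {x} y z → ¬ x ≈ 0# → x * y ≈ x * z → y ≈ z
  *-cancelˡ-nonzero {x} y z x≉0 xy≈xz = begin
    y              ≈⟨ *-identityˡ y ⟨
    1# * y         ≈⟨ *-congʳ x⁻¹x≈1 ⟨
    (x⁻¹ * x) * y  ≈⟨ *-assoc _ _ _ ⟩
    x⁻¹ * (x * y)  ≈⟨ *-congˡ xy≈xz ⟩
    x⁻¹ * (x * z)  ≈⟨ *-assoc _ _ _ ⟨
    (x⁻¹ * x) * z  ≈⟨ *-congʳ x⁻¹x≈1 ⟩
    1# * z         ≈⟨ *-identityˡ z ⟩
    z              ∎
    where
    x⁻¹ = proj₁ (proj₂ isField x x≉0)
    x⁻¹x≈1 : x⁻¹ * x ≈ 1#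
    x⁻¹x≈1 = trans (*-comm _ _) (proj₂ (proj₂ isField x x≉0))

  x*y≈0⇒y≈0 : ∀ {x y} → ¬ x ≈ 0# → x * y ≈ 0# → y ≈ 0#
  x*y≈0⇒y≈0 {x} {y} x≉0 xy≈0 = *-cancelˡ-nonzero y 0# x≉0 (trans xy≈0 (sym (zeroʳ x)))

  x≉0∧y≉0⇒x*y≉0 : ∀ {x y} → ¬ x ≈ 0# → ¬ y ≈ 0# → ¬ x * y ≈ 0#
  x≉0∧y≉0⇒x*y≉0 x≉0 y≉0 xy≈0 = y≉0 (x*y≈0⇒y≈0 x≉0 xy≈0)

  private
    -- Conjugating by the enumeration turns a bijection of the field into a permutation of indices,
    -- along which sums and products over the field can be reindexed.
    bijection⇒permutation : (f g : Carrier → Carrier) →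
      (∀ {x y} → x ≈ y → f x ≈ f y) → (∀ {x y} → x ≈ y → g x ≈ g y) →
      (∀ x → f (g x) ≈ x) → (∀ x → g (f x) ≈ x) → Permutation N N
    bijection⇒permutation f g f-cong g-cong fg gf =
      permutation (to ∘ f ∘ from) (to ∘ g ∘ from)
        (λ i → ≡.trans (to-cong (trans (f-cong (strictlyInverseʳ _)) (fg _))) (strictlyInverseˡ i))
        (λ i → ≡.trans (to-cong (trans (g-cong (strictlyInverseʳ _)) (gf _))) (strictlyInverseˡ i))

  -- The sum over the whole field is invariant under the translation x ↦ x + 1.
  N·1≈0 : N · 1# ≈ 0#
  N·1≈0 = identityʳ-unique (Sum.sum from) (N · 1#) (sym (begin
    Sum.sum from                                    ≈⟨ Sum.sum-permute from shift ⟩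
    Sum.sum (λ i → from (to (from i + 1#)))         ≈⟨ Sum.sum-cong-≋ {n = N} (λ i → strictlyInverseʳ (from i + 1#)) ⟩
    Sum.sum (λ i → from i + 1#)                     ≈⟨ Sum.∑-distrib-+ from (λ _ → 1#) ⟩
    Sum.sum from + Sum.sum {n = N} (λ _ → 1#)       ≈⟨ +-congˡ (Sum.sum-replicate N) ⟩
    Sum.sum from + N · 1#                           ∎))
    where
    cancel : ∀ x y z → y + z ≈ 0# → (x + y) + z ≈ x
    cancel x y z y+z≈0 = trans (+-assoc _ _ _) (trans (+-congˡ y+z≈0) (+-identityʳ x))
    shift = bijection⇒permutation (_+ 1#) (_- 1#) +-congʳ +-congʳ
      (λ x → cancel x _ _ (-‿inverseˡ 1#)) (λ x → cancel x _ _ (-‿inverseʳ 1#))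

  product-nonzero : ∀ {m} (f : Fin m → Carrier) → (∀ i → ¬ f i ≈ 0#) → ¬ Product.sum f ≈ 0#
  product-nonzero {zero}  f f≉0 = proj₁ isField
  product-nonzero {suc m} f f≉0 =
    x≉0∧y≉0⇒x*y≉0 (f≉0 zero) (product-nonzero (f ∘ suc) (f≉0 ∘ suc))

  product-supported-at : ∀ {m} (f : Fin m → Carrier) i → (∀ j → j ≢ i → f j ≈ 1#) →
                         Product.sum f ≈ f i
  product-supported-at {suc m} f i f≈1 = begin
    Product.sum f                      ≈⟨ Product.sum-remove f ⟩
    f i * Product.sum (removeAt f i)   ≈⟨ *-congˡ (Product.sum-cong-≋ (λ j → f≈1 _ (Fin.punchInᵢ≢i i j))) ⟩
    f i * Product.sum {n = m} (λ _ → 1#) ≈⟨ *-congˡ (Product.sum-replicate-zero m) ⟩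
    f i * 1#                           ≈⟨ *-identityʳ _ ⟩
    f i                                ∎

  private
    nonzeroPart : Carrier → Carrier
    nonzeroPart y with y ≈? 0#
    ... | yes _ = 1#
    ... | no  _ = y

    zeroPart : Carrier → Carrier → Carrier
    zeroPart x y with y ≈? 0#
    ... | yes _ = x
    ... | no  _ = 1#

    nonzeroPart-cong : ∀ {y z} → y ≈ z → nonzeroPart y ≈ nonzeroPart z
    nonzeroPart-cong {y} {z} y≈z with y ≈? 0# | z ≈? 0#
    ... | yes _   | yes _   = refl
    ... | no  _   | no  _   = y≈z
    ... | yes y≈0 | no  z≉0 = contradiction (trans (sym y≈z) y≈0) z≉0
    ... | no  y≉0 | yes z≈0 = contradiction (trans y≈z z≈0) y≉0

    nonzeroPart≉0 : ∀ y → ¬ nonzeroPart y ≈ 0#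
    nonzeroPart≉0 y with y ≈? 0#
    ... | yes _   = proj₁ isField
    ... | no  y≉0 = y≉0

    zeroPart≈1 : ∀ x y → ¬ y ≈ 0# → zeroPart x y ≈ 1#
    zeroPart≈1 x y y≉0 with y ≈? 0#
    ... | yes y≈0 = contradiction y≈0 y≉0
    ... | no  _   = refl

    zeroPart≈x : ∀ x y → y ≈ 0# → zeroPart x y ≈ x
    zeroPart≈x x y y≈0 with y ≈? 0#
    ... | yes _   = refl
    ... | no  y≉0 = contradiction y≈0 y≉0

    -- Replacing 0 by 1 breaks compatibility with multiplication by x only at y = 0, where the left
    -- side lacks a factor x. There `zeroPart x y` supplies it; elsewhere it is 1.
    nonzeroPart-* : ∀ x y → ¬ x ≈ 0# →
                    nonzeroPart (x * y) * zeroPart x y ≈ x * nonzeroPart y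
    nonzeroPart-* x y x≉0 with y ≈? 0# | (x * y) ≈? 0#
    ... | yes _   | yes _    = *-comm 1# x
    ... | no  _   | no  _    = *-identityʳ (x * y)
    ... | yes y≈0 | no  xy≉0 = contradiction (trans (*-congˡ y≈0) (zeroʳ x)) xy≉0
    ... | no  y≉0 | yes xy≈0 = contradiction (x*y≈0⇒y≈0 x≉0 xy≈0) y≉0

  -- Multiplication by x ≠ 0 permutes the nonzero elements. The product over
  -- the whole field is taken with 0 replaced by 1, and zeroPart is
  -- the correction at 0.
  x^N≈x : ∀ x → x ^ᴷ N ≈ x
  x^N≈x x with x ≈? 0#
  ... | yes x≈0 = trans (^-congˡ N x≈0) (trans (0^N≈0 N (to 0#)) (sym x≈0))
    where
    0^N≈0 : ∀ n → Fin n → 0# ^ᴷ n ≈ 0#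
    0^N≈0 (suc n) _ = zeroˡ _
  ... | no  x≉0 = *-cancelˡ-nonzero (x ^ᴷ N) x (product-nonzero units (λ i → nonzeroPart≉0 (from i)))
    (sym (begin
      P * x                                      ≈⟨ *-cong P-scaled zeros≈x ⟨
      Product.sum (λ i → nonzeroPart (x * from i)) * Product.sum (λ i → zeroPart x (from i))
        ≈⟨ Product.∑-distrib-+ {N} _ _ ⟨
      Product.sum (λ i → nonzeroPart (x * from i) * zeroPart x (from i))
        ≈⟨ Product.sum-cong-≋ {N} (λ i → nonzeroPart-* x (from i) x≉0) ⟩
      Product.sum (λ i → x * units i)            ≈⟨ Product.∑-distrib-+ {N} (λ _ → x) units ⟩
      Product.sum {n = N} (λ _ → x) * P          ≈⟨ *-congʳ (Product.sum-replicate N) ⟩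
      (x ^ᴷ N) * P                               ≈⟨ *-comm _ P ⟩
      P * (x ^ᴷ N)                               ∎))
    where
    units = λ i → nonzeroPart (from i)
    P     = Product.sum units
    x⁻¹   = proj₁ (proj₂ isField x x≉0)
    xx⁻¹≈1 = proj₂ (proj₂ isField x x≉0)
    cancel : ∀ a b y → a * b ≈ 1# → a * (b * y) ≈ y
    cancel a b y ab≈1 = trans (sym (*-assoc a b y)) (trans (*-congʳ ab≈1) (*-identityˡ y))
    scale = bijection⇒permutation (x *_) (x⁻¹ *_) *-congˡ *-congˡ
      (λ y → cancel x x⁻¹ y xx⁻¹≈1) (λ y → cancel x⁻¹ x y (trans (*-comm _ _) xx⁻¹≈1))
    P-scaled : Product.sum (λ i → nonzeroPart (x * from i)) ≈ P
    P-scaled = sym (trans (Product.sum-permute units scale)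
      (Product.sum-cong-≋ {N} (λ i → nonzeroPart-cong (strictlyInverseʳ (x * from i)))))
    zeros≈x : Product.sum (λ i → zeroPart x (from i)) ≈ x
    zeros≈x = trans
      (product-supported-at (λ i → zeroPart x (from i)) (to 0#) (λ j j≢0 →
        zeroPart≈1 x (from j) (λ from-j≈0 → j≢0 (≡.trans (≡.sym (strictlyInverseˡ j)) (to-cong from-j≈0)))))
      (zeroPart≈x x _ (strictlyInverseʳ 0#))

  -- Characteristic p and additivity of p-power maps.

  module Characteristic {p} (prime : Prime p) (m : ℕ) (N≡p^m : N ≡ p ^ m) where

    -- The multiple p^m · 1 vanishes and equals the m-th power of p · 1. A field has no zero
    -- divisors, so stripping one factor at a time either finds p · 1 = 0 or ends in 1 = 0.
    p·1≈0 : p · 1# ≈ 0#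
    p·1≈0 = go m (trans (sym (×-congˡ {1#} N≡p^m)) N·1≈0)
      where
      go : ∀ k → (p ^ k) · 1# ≈ 0# → p · 1# ≈ 0#
      go zero    1·1≈0   = contradiction (trans (sym (×-homo-1 1#)) 1·1≈0) (proj₁ isField)
      go (suc k) p·p^k≈0 with (p · 1#) ≈? 0#
      ... | yes p≈0 = p≈0
      ... | no  p≉0 = go k (x*y≈0⇒y≈0 p≉0 (trans (sym (×1-homo-* p (p ^ k))) p·p^k≈0))

    p∣n⇒n·x≈0 : ∀ {n} → p ∣ n → ∀ x → n · x ≈ 0#
    p∣n⇒n·x≈0 (divides d ≡.refl) x = begin
      (d ℕ.* p) · x          ≈⟨ ×-assocˡ x d p ⟨
      d · (p · x)            ≈⟨ ×-congʳ d (begin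
        p · x                ≈⟨ ×-congʳ p (*-identityˡ x) ⟨
        p · (1# * x)         ≈⟨ ×-assoc-* p 1# x ⟨
        (p · 1#) * x         ≈⟨ *-congʳ p·1≈0 ⟩
        0# * x               ≈⟨ zeroˡ x ⟩
        0#                   ∎) ⟩
      d · 0#                 ≈⟨ Sum.sum-replicate d ⟨
      Sum.sum {n = d} (λ _ → 0#) ≈⟨ Sum.sum-replicate-zero d ⟩
      0#                     ∎

    private
      -- With p written as `suc r` the p + 1 terms split into the first, r middle ones and the last.
      -- The middle binomial coefficients are divisible by p.
      expansion : ∀ r → p ≡ suc r → ∀ x y → Binomial.binomialExpansion x y p ≈ x ^ᴷ p + y ^ᴷ p
      expansion r ≡.refl x y = begin
        t zero + Sum.sum (t ∘ suc)          ≈⟨ +-congˡ (Sum.sum-init-last (t ∘ suc)) ⟩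
        t zero + (Sum.sum (λ i → t (suc (inject₁ i))) + t (suc (fromℕ r)))
                                            ≈⟨ +-congˡ (+-congʳ (Sum.sum-cong-≋ {r} middle)) ⟩
        t zero + (Sum.sum {n = r} (λ _ → 0#) + t (suc (fromℕ r)))
                                            ≈⟨ +-congˡ (+-congʳ (Sum.sum-replicate-zero r)) ⟩
        t zero + (0# + t (suc (fromℕ r)))   ≈⟨ +-congˡ (+-identityˡ _) ⟩
        t zero + t (suc (fromℕ r))          ≈⟨ +-cong first last ⟩
        y ^ᴷ p + x ^ᴷ p                     ≈⟨ +-comm _ _ ⟩
        x ^ᴷ p + y ^ᴷ p                     ∎
        where
        t = binomialTerm x y p
        middle : ∀ i → t (suc (inject₁ i)) ≈ 0#
        middle i = p∣n⇒n·x≈0 (prime∣binomial prime _ (s≤s ℕ.z≤n)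
          (s≤s (≡.subst (ℕ._< r) (≡.sym (Fin.toℕ-inject₁ i)) (Fin.toℕ<n i)))) _
        pC0≡1 : p C 0 ≡ 1
        pC0≡1 = ≡.trans (nCk≡nC[n∸k] {0} {p} ℕ.z≤n) (nCn≡1 p)
        first : t zero ≈ y ^ᴷ p
        first = trans (×-congˡ pC0≡1) (trans (×-homo-1 _) (*-identityˡ _))
        last : t (suc (fromℕ r)) ≈ x ^ᴷ p
        last = begin
          (p C suc (toℕ (fromℕ r))) · (x ^ᴷ suc (toℕ (fromℕ r)) * y ^ᴷ (r ∸ toℕ (fromℕ r)))
            ≡⟨ ≡.cong (λ k → (p C suc k) · (x ^ᴷ suc k * y ^ᴷ (r ∸ k))) (Fin.toℕ-fromℕ r) ⟩
          (p C p) · (x ^ᴷ p * y ^ᴷ (r ∸ r))   ≈⟨ ×-congˡ (nCn≡1 p) ⟩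
          1 · (x ^ᴷ p * y ^ᴷ (r ∸ r))         ≈⟨ ×-homo-1 _ ⟩
          x ^ᴷ p * y ^ᴷ (r ∸ r)               ≈⟨ *-congˡ (^-congʳ y (ℕ.n∸n≡0 r)) ⟩
          x ^ᴷ p * 1#                         ≈⟨ *-identityʳ _ ⟩
          x ^ᴷ p                              ∎

    [x+y]^p : ∀ x y → (x + y) ^ᴷ p ≈ x ^ᴷ p + y ^ᴷ p
    [x+y]^p x y = trans (Binomial.theorem p x y)
      (expansion (ℕ.pred p) (≡.sym (ℕ.suc-pred p {{prime⇒nonZero prime}})) x y)

    [x+y]^p^k : ∀ k x y → (x + y) ^ᴷ (p ^ k) ≈ x ^ᴷ (p ^ k) + y ^ᴷ (p ^ k)
    [x+y]^p^k zero    x y = trans (*-identityʳ _) (sym (+-cong (*-identityʳ x) (*-identityʳ y)))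
    [x+y]^p^k (suc k) x y = begin
      (x + y) ^ᴷ (p ℕ.* p ^ k)                  ≈⟨ ^-assocʳ (x + y) p (p ^ k) ⟨
      ((x + y) ^ᴷ p) ^ᴷ (p ^ k)                 ≈⟨ ^-congˡ (p ^ k) ([x+y]^p x y) ⟩
      (x ^ᴷ p + y ^ᴷ p) ^ᴷ (p ^ k)              ≈⟨ [x+y]^p^k k _ _ ⟩
      (x ^ᴷ p) ^ᴷ (p ^ k) + (y ^ᴷ p) ^ᴷ (p ^ k) ≈⟨ +-cong (^-assocʳ x p (p ^ k)) (^-assocʳ y p (p ^ k)) ⟩
      x ^ᴷ (p ℕ.* p ^ k) + y ^ᴷ (p ℕ.* p ^ k)   ∎

-- Sums and linear combinations over a finite field.

funToFin-cong : ∀ {m n} {f g : Fin m → Fin n} → (∀ i → f i ≡ g i) → Fin.funToFin f ≡ Fin.funToFin g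
funToFin-cong {zero}  f≗g = ≡.refl
funToFin-cong {suc m} f≗g = ≡.cong₂ combine (f≗g zero) (funToFin-cong (f≗g ∘ suc))

module LinearAlgebra {c ℓ} (R : CommutativeRing c ℓ) (isField : IsField R)
                     {N : ℕ} (card : HasCard R N) (q : ℕ) where
  open CommutativeRing R hiding (zero)
  open Geometry R q
  open FiniteField R isField card
  open Inverse card using (to; from; to-cong; strictlyInverseˡ; strictlyInverseʳ)
  open import Algebra.Properties.Semiring.Sum semiring
    using (sum; ∑-distrib-+; ∑-comm; *-distribˡ-sum; sum-replicate-zero)
  open import Algebra.Properties.Group +-group using (x∙y⁻¹≈ε⇒x≈y; x≈y⇒x∙y⁻¹≈ε)
  open import Algebra.Properties.Ring ring using (-1*x≈-x; [y-z]x≈yx-zx)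
  open import Algebra.Properties.CommutativeSemigroup *-commutativeSemigroup using (x∙yz≈y∙xz)
  open import Relation.Binary.Reasoning.Setoid setoid

  infix 4 _≋_
  _≋_ : ∀ {n} → Vect n → Vect n → Set ℓ
  v ≋ w = ∀ k → v k ≈ w k

  sumF≈sum : ∀ n (f : Vect n) → sumF n f ≈ sum f
  sumF≈sum zero    f = refl
  sumF≈sum (suc n) f = +-congˡ (sumF≈sum n (f ∘ suc))

  sumF-cong : ∀ {n} {f g : Vect n} → f ≋ g → sumF n f ≈ sumF n g
  sumF-cong {zero}  f≋g = refl
  sumF-cong {suc n} f≋g = +-cong (f≋g zero) (sumF-cong (f≋g ∘ suc))

  sumF-0 : ∀ {n} {f : Vect n} → (∀ i → f i ≈ 0#) → sumF n f ≈ 0#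
  sumF-0 {n} f≈0 = trans (sumF-cong f≈0) (trans (sumF≈sum n _) (sum-replicate-zero n))

  sumF-+ : ∀ {n} (f g : Vect n) → sumF n (λ i → f i + g i) ≈ sumF n f + sumF n g
  sumF-+ {n} f g = trans (sumF≈sum n _) (trans (∑-distrib-+ f g)
    (+-cong (sym (sumF≈sum n f)) (sym (sumF≈sum n g))))

  *-distribˡ-sumF : ∀ {n} x (f : Vect n) → x * sumF n f ≈ sumF n (λ i → x * f i)
  *-distribˡ-sumF {n} x f = trans (*-congˡ (sumF≈sum n f))
    (trans (*-distribˡ-sum x f) (sym (sumF≈sum n _)))

  *-distribʳ-sumF : ∀ {n} (f : Vect n) x → sumF n f * x ≈ sumF n (λ i → f i * x)
  *-distribʳ-sumF {n} f x = trans (*-comm _ x) (trans (*-distribˡ-sumF x f) (sumF-cong {n} (λ i → *-comm x (f i))))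

  sumF-comm : ∀ {m n} (f : Fin m → Fin n → K) →
              sumF m (λ i → sumF n (f i)) ≈ sumF n (λ j → sumF m (λ i → f i j))
  sumF-comm {m} {n} f = begin
    sumF m (λ i → sumF n (f i))        ≈⟨ sumF-cong (λ i → sumF≈sum n (f i)) ⟩
    sumF m (λ i → sum (f i))           ≈⟨ sumF≈sum m _ ⟩
    sum (λ i → sum (f i))              ≈⟨ ∑-comm f ⟩
    sum (λ j → sum (λ i → f i j))      ≈⟨ sumF≈sum n _ ⟨
    sumF n (λ j → sum (λ i → f i j))   ≈⟨ sumF-cong (λ j → sumF≈sum m (λ i → f i j)) ⟨
    sumF n (λ j → sumF m (λ i → f i j)) ∎

  sumF-++ : ∀ m {n} (f : Vect (m ℕ.+ n)) →
            sumF (m ℕ.+ n) f ≈ sumF m (λ i → f (i ↑ˡ n)) + sumF n (λ j → f (m ↑ʳ j))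
  sumF-++ zero    f = sym (+-identityˡ _)
  sumF-++ (suc m) f = trans (+-congˡ (sumF-++ m (f ∘ suc))) (sym (+-assoc _ _ _))

  sumF-combine : ∀ m {n} (f : Vect (m ℕ.* n)) →
                 sumF (m ℕ.* n) f ≈ sumF m (λ i → sumF n (λ j → f (combine i j)))
  sumF-combine zero        f = refl
  sumF-combine (suc m) {n} f =
    trans (sumF-++ n f) (+-congˡ (sumF-combine m (λ s → f (n ↑ʳ s))))

  -- Splits a sum over pairs coded as single indices into a double sum. The third argument of f
  -- keeps the coded index for summands that also use it unsplit.
  sumF-remQuot : ∀ {m n} (f : Fin m → Fin n → Fin (m ℕ.* n) → K) →
                 sumF (m ℕ.* n) (λ s → f (proj₁ (remQuot {m} n s)) (proj₂ (remQuot {m} n s)) s)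
                 ≈ sumF m (λ i → sumF n (λ j → f i j (combine i j)))
  sumF-remQuot {m} {n} f = trans (sumF-combine m _)
    (sumF-cong (λ i → sumF-cong (λ j →
      reflexive (≡.cong (λ ij → f (proj₁ ij) (proj₂ ij) (combine i j)) (Fin.remQuot-combine i j)))))

  sumF-select : ∀ {n} (f : Vect n) i → (∀ j → j ≢ i → f j ≈ 0#) → sumF n f ≈ f i
  sumF-select f zero    f≈0 = trans (+-congˡ (sumF-0 (λ j → f≈0 (suc j) λ ()))) (+-identityʳ _)
  sumF-select f (suc i) f≈0 = trans
    (+-cong (f≈0 zero λ ()) (sumF-select (f ∘ suc) i (λ j j≢i → f≈0 (suc j) (j≢i ∘ Fin.suc-injective))))
    (+-identityˡ _)

  lincomb-congˡ : ∀ {m n} (vs : Fin m → Vect n) {as bs : Vect m} →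
                  as ≋ bs → lincomb as vs ≋ lincomb bs vs
  lincomb-congˡ vs as≋bs k = sumF-cong (λ i → *-congʳ (as≋bs i))

  lincomb-congʳ : ∀ {m n} (as : Vect m) {vs ws : Fin m → Vect n} →
                  (∀ i → vs i ≋ ws i) → lincomb as vs ≋ lincomb as ws
  lincomb-congʳ as vs≋ws k = sumF-cong (λ i → *-congˡ (vs≋ws i k))

  lincomb-zeroˡ : ∀ {m n} {as : Vect m} (vs : Fin m → Vect n) →
                  (∀ i → as i ≈ 0#) → ∀ k → lincomb as vs k ≈ 0#
  lincomb-zeroˡ vs as≈0 k = sumF-0 (λ i → trans (*-congʳ (as≈0 i)) (zeroˡ _))

  lincomb-sub : ∀ {m n} (as bs : Vect m) (vs : Fin m → Vect n) k →
                lincomb (λ i → as i - bs i) vs k ≈ lincomb as vs k - lincomb bs vs k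
  lincomb-sub {m} as bs vs k = begin
    sumF m (λ i → (as i - bs i) * vs i k)
      ≈⟨ sumF-cong (λ i → [y-z]x≈yx-zx (vs i k) (as i) (bs i)) ⟩
    sumF m (λ i → as i * vs i k - bs i * vs i k)
      ≈⟨ sumF-+ (λ i → as i * vs i k) (λ i → - (bs i * vs i k)) ⟩
    lincomb as vs k + sumF m (λ i → - (bs i * vs i k))
      ≈⟨ +-congˡ (sumF-cong {m} (λ i → -1*x≈-x (bs i * vs i k))) ⟨
    lincomb as vs k + sumF m (λ i → - 1# * (bs i * vs i k))
      ≈⟨ +-congˡ (*-distribˡ-sumF (- 1#) (λ i → bs i * vs i k)) ⟨
    lincomb as vs k + - 1# * lincomb bs vs k
      ≈⟨ +-congˡ (-1*x≈-x _) ⟩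
    lincomb as vs k - lincomb bs vs k ∎

  -- This is associativity of the matrix product, proved by interchanging the two sums.
  lincomb-assoc : ∀ {l m n} (as : Vect l) (A : Fin l → Vect m) (vs : Fin m → Vect n) →
                  lincomb as (λ i → lincomb (A i) vs) ≋ lincomb (lincomb as A) vs
  lincomb-assoc {l} {m} as A vs k = begin
    sumF l (λ i → as i * sumF m (λ j → A i j * vs j k))
      ≈⟨ sumF-cong {l} (λ i → *-distribˡ-sumF (as i) (λ j → A i j * vs j k)) ⟩
    sumF l (λ i → sumF m (λ j → as i * (A i j * vs j k)))
      ≈⟨ sumF-comm (λ i j → as i * (A i j * vs j k)) ⟩
    sumF m (λ j → sumF l (λ i → as i * (A i j * vs j k)))
      ≈⟨ sumF-cong (λ j → sumF-cong (λ i → *-assoc (as i) (A i j) (vs j k))) ⟨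
    sumF m (λ j → sumF l (λ i → as i * A i j * vs j k))
      ≈⟨ sumF-cong (λ j → *-distribʳ-sumF (λ i → as i * A i j) (vs j k)) ⟨
    sumF m (λ j → sumF l (λ i → as i * A i j) * vs j k) ∎

  linIndep⇒injective : ∀ {m n} (vs : Fin m → Vect n) → LinIndep vs →
                       ∀ {as bs} → lincomb as vs ≋ lincomb bs vs → as ≋ bs
  linIndep⇒injective vs indep {as} {bs} eq i = x∙y⁻¹≈ε⇒x≈y (as i) (bs i)
    (indep (λ i → as i - bs i) (λ k → trans (lincomb-sub as bs vs k) (x≈y⇒x∙y⁻¹≈ε (eq k))) i)

  inSpan-member : ∀ {m n} (vs : Fin m → Vect n) i → InSpan vs (vs i)
  inSpan-member vs i = δ , λ k → sym (begin
    lincomb δ vs k    ≈⟨ sumF-select (λ j → δ j * vs j k) i (λ j j≢i → trans (*-congʳ (δ≈0 j j≢i)) (zeroˡ _)) ⟩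
    δ i * vs i k      ≈⟨ *-congʳ δ≈1 ⟩
    1# * vs i k       ≈⟨ *-identityˡ _ ⟩
    vs i k            ∎)
    where
    δ : Fin _ → K
    δ j with j Fin.≟ i
    ... | yes _ = 1#
    ... | no  _ = 0#
    δ≈0 : ∀ j → j ≢ i → δ j ≈ 0#
    δ≈0 j j≢i with j Fin.≟ i
    ... | yes j≡i = contradiction j≡i j≢i
    ... | no  _   = refl
    δ≈1 : δ i ≈ 1#
    δ≈1 with i Fin.≟ i
    ... | yes _   = refl
    ... | no  i≢i = contradiction ≡.refl i≢i

  inSpan-trans : ∀ {l m n} (us : Fin l → Vect n) (vs : Fin m → Vect n) {w} →
                 (∀ i → InSpan vs (us i)) → InSpan us w → InSpan vs w
  inSpan-trans us vs us⊆vs (as , w≋) =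
    lincomb as (proj₁ ∘ us⊆vs) ,
    λ k → trans (w≋ k) (trans (lincomb-congʳ as (proj₂ ∘ us⊆vs) k)
                              (lincomb-assoc as (proj₁ ∘ us⊆vs) vs k))

  -- Dimension arguments by counting vectors.

  encode : ∀ {n} → Vect n → Fin (N ^ n)
  encode v = Fin.funToFin (to ∘ v)

  decode : ∀ {n} → Fin (N ^ n) → Vect n
  decode i k = from (Fin.finToFun i k)

  decode-encode : ∀ {n} (v : Vect n) → decode (encode v) ≋ v
  decode-encode v k = trans (reflexive (≡.cong from (Fin.finToFun-funToFin (to ∘ v) k))) (strictlyInverseʳ (v k))

  encode-cong : ∀ {n} {v w : Vect n} → v ≋ w → encode v ≡ encode w
  encode-cong v≋w = funToFin-cong (λ k → to-cong (v≋w k))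

  encode-injective : ∀ {n} {v w : Vect n} → encode v ≡ encode w → v ≋ w
  encode-injective {v = v} {w} eq k = begin
    v k                   ≈⟨ decode-encode v k ⟨
    decode (encode v) k   ≡⟨ ≡.cong (λ i → decode i k) eq ⟩
    decode (encode w) k   ≈⟨ decode-encode w k ⟩
    w k                   ∎

  decode-injective : ∀ {n} {i j : Fin (N ^ n)} → decode {n} i ≋ decode j → i ≡ j
  decode-injective {n} {i} {j} eq = ≡.trans (≡.sym (encode-decode i)) (≡.trans (encode-cong eq) (encode-decode j))
    where
    encode-decode : ∀ i → encode (decode {n} i) ≡ i
    encode-decode i = ≡.trans (funToFin-cong (λ k → strictlyInverseˡ (Fin.finToFun {n = n} i k)))
                              (Fin.funToFin-finToFin {n} i)

  -- The pigeonhole principle is transported along the codes. The preimage is a code because f is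
  -- evaluated only at decoded vectors; f may thus be a choice function that does not respect `≋`.
  injective⇒surjectiveᵛ : ∀ {n} (f : Vect n → Vect n) → (∀ {v w} → f v ≋ f w → v ≋ w) →
                          ∀ w → ∃ λ i → f (decode i) ≋ w
  injective⇒surjectiveᵛ f inj w
    with i , eq ← injective⇒surjective (encode ∘ f ∘ decode) (λ eq → decode-injective (inj (encode-injective eq))) (encode w)
    = i , encode-injective eq

  -- Independence makes the map from coefficients to combinations injective on the finite set of
  -- vectors, hence surjective.
  linIndep⇒spanning : ∀ {n} (vs : Fin n → Vect n) → LinIndep vs → ∀ v → InSpan vs v
  linIndep⇒spanning vs indep v
    with i , eq ← injective⇒surjectiveᵛ (λ as → lincomb as vs) (linIndep⇒injective vs indep) v
    = decode i , λ k → sym (eq k)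

  -- A section of the surjection as ↦ lincomb as vs is injective, hence
  -- surjective, so the surjection is a bijection.
  spanning⇒linIndep : ∀ {n} (vs : Fin n → Vect n) → (∀ v → InSpan vs v) → LinIndep vs
  spanning⇒linIndep {n} vs spans as comb≈0 = λ i → trans (as≋bs i) (lincomb-zero i)
    where
    section : Vect n → Vect n
    section v = proj₁ (spans v)
    isSection : ∀ v → lincomb (section v) vs ≋ v
    isSection v k = sym (proj₂ (spans v) k)
    section-injective : ∀ {v w} → section v ≋ section w → v ≋ w
    section-injective {v} {w} eq k = trans (sym (isSection v k))
      (trans (lincomb-congˡ vs eq k) (isSection w k))
    preimage : ∀ bs → ∃ λ i → section (decode i) ≋ bs
    preimage = injective⇒surjectiveᵛ section section-injective
    zeroᵛ : Vect n
    zeroᵛ _ = 0#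
    decoded : ∀ bs → decode (proj₁ (preimage bs)) ≋ lincomb bs vs
    decoded bs k = trans (sym (isSection _ k)) (lincomb-congˡ vs (proj₂ (preimage bs)) k)
    -- By `decoded`, the preimage of a coefficient vector under the section decodes to its linear
    -- combination. Both `as` and `zeroᵛ` have combination 0, so their preimages coincide.
    as≋bs : as ≋ section (decode (proj₁ (preimage zeroᵛ)))
    as≋bs i = trans (sym (proj₂ (preimage as) i)) (reflexive (≡.cong (λ j → section (decode j) i)
      (decode-injective (λ k → trans (decoded as k) (trans (comb≈0 k)
        (sym (trans (decoded zeroᵛ k) (lincomb-zeroˡ vs (λ _ → refl) k))))))))
    lincomb-zero : section (decode (proj₁ (preimage zeroᵛ))) ≋ zeroᵛ
    lincomb-zero = proj₂ (preimage zeroᵛ)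

  -- The elements 0 and 1 are distinct. This makes `N ^ n` grow strictly with n, as the pigeonhole
  -- argument in `dependence` requires.
  1<N : 1 ℕ.< N
  1<N = two (to 0#) (to 1#) (λ 0≡1 → proj₁ isField (begin
    1#           ≈⟨ strictlyInverseʳ 1# ⟨
    from (to 1#) ≡⟨ ≡.cong from 0≡1 ⟨
    from (to 0#) ≈⟨ strictlyInverseʳ 0# ⟩
    0#           ∎))
    where
    two : ∀ {n} (i j : Fin n) → i ≢ j → 1 ℕ.< n
    two {suc zero}    zero zero i≢j = contradiction ≡.refl i≢j
    two {suc (suc _)} _    _    _   = s≤s (s≤s ℕ.z≤n)

  -- There are more coefficient vectors than possible combinations, so two distinct ones have the
  -- same combination; their difference is the relation.
  dependence : ∀ {m n} → n ℕ.< m → (vs : Fin m → Vect n) →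
               ∃ λ as → ¬ (∀ i → as i ≈ 0#) × (∀ k → lincomb as vs k ≈ 0#)
  dependence {m} {n} n<m vs
    with i , j , i<j , eq ← Fin.pigeonhole (ℕ.^-monoʳ-< N 1<N n<m) (λ i → encode (lincomb (decode {m} i) vs))
    = (λ t → decode i t - decode j t)
    , (λ i-j≈0 → Fin.<⇒≢ i<j (decode-injective {m} (λ t → x∙y⁻¹≈ε⇒x≈y _ _ (i-j≈0 t))))
    , λ k → trans (lincomb-sub (decode i) (decode j) vs k) (x≈y⇒x∙y⁻¹≈ε (encode-injective eq k))

  -- If no nonzero functional kills the whole family u, an independent
  -- subfamily is extended by a member not killed by a functional that kills
  -- the members already chosen.
  independent-subfamily : ∀ {i} {I : Set i} {m} (u : I → Vect m) →
    (∀ φ → ¬ (∀ t → φ t ≈ 0#) → ∃ λ x → ¬ sumF m (λ t → φ t * u x t) ≈ 0#) →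
    ∀ n → n ℕ.≤ m → Σ (Fin n → I) λ e → LinIndep (u ∘ e)
  independent-subfamily u total zero    _   = (λ ()) , λ _ _ ()
  independent-subfamily {I = I} {m} u total (suc n) n<m
    with e , indep ← independent-subfamily u total n (ℕ.<⇒≤ n<m)
    -- Transposing the n chosen vectors gives m vectors of length n < m. A relation between these is
    -- a nonzero functional that kills every chosen vector.
    with φ , φ≉0 , φ-kills ← dependence n<m (λ t j → u (e j) t)
    with x , φx≉0 ← total φ φ≉0
    = x ∷ e , extended
    where
    extended : LinIndep (u ∘ (x ∷ e))
    extended bs comb≈0 = λ { zero → b₀≈0 ; (suc j) → rest j }
      where
      -- Applying φ to the vanishing combination removes every old member and leaves only the term
      -- of x.
      φ-comb : bs zero * sumF m (λ t → φ t * u x t) ≈ 0#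
      φ-comb = begin
        bs zero * sumF m (λ t → φ t * u x t)
          ≈⟨ +-identityʳ _ ⟨
        bs zero * sumF m (λ t → φ t * u x t) + 0#
          ≈⟨ +-congˡ (sumF-0 (λ j → trans (*-congˡ (φ-kills j)) (zeroʳ (bs (suc j))))) ⟨
        sumF (suc n) (λ j → bs j * sumF m (λ t → φ t * u ((x ∷ e) j) t))
          ≈⟨ sumF-cong (λ j → *-distribˡ-sumF (bs j) (λ t → φ t * u ((x ∷ e) j) t)) ⟩
        sumF (suc n) (λ j → sumF m (λ t → bs j * (φ t * u ((x ∷ e) j) t)))
          ≈⟨ sumF-comm (λ j t → bs j * (φ t * u ((x ∷ e) j) t)) ⟩
        sumF m (λ t → sumF (suc n) (λ j → bs j * (φ t * u ((x ∷ e) j) t)))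
          ≈⟨ sumF-cong (λ t → sumF-cong (λ j → x∙yz≈y∙xz (bs j) (φ t) (u ((x ∷ e) j) t))) ⟩
        sumF m (λ t → sumF (suc n) (λ j → φ t * (bs j * u ((x ∷ e) j) t)))
          ≈⟨ sumF-cong (λ t → *-distribˡ-sumF (φ t) (λ j → bs j * u ((x ∷ e) j) t)) ⟨
        sumF m (λ t → φ t * lincomb bs (u ∘ (x ∷ e)) t)
          ≈⟨ sumF-0 (λ t → trans (*-congˡ (comb≈0 t)) (zeroʳ (φ t))) ⟩
        0# ∎
      b₀≈0 : bs zero ≈ 0#
      b₀≈0 = x*y≈0⇒y≈0 φx≉0 (trans (*-comm _ _) φ-comb)
      rest : ∀ j → bs (suc j) ≈ 0#
      rest = indep (bs ∘ suc) (λ t → begin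
        lincomb (bs ∘ suc) (u ∘ e) t                     ≈⟨ +-identityˡ _ ⟨
        0# + lincomb (bs ∘ suc) (u ∘ e) t                ≈⟨ +-congʳ (trans (*-congʳ b₀≈0) (zeroˡ _)) ⟨
        bs zero * u x t + lincomb (bs ∘ suc) (u ∘ e) t   ≈⟨ comb≈0 t ⟩
        0#                                               ∎)

-- The Frobenius map on a field with q³ elements.

module CubicExtension {c ℓ} (R : CommutativeRing c ℓ) (q : ℕ) (primePower : IsPrimePower q)
                      (isField : IsField R) (card : HasCard R (q ^ 3)) where
  open CommutativeRing R hiding (zero)
  open Geometry R q
  open FiniteField R isField card
  open LinearAlgebra R isField card q
  open import Algebra.Properties.CommutativeSemiring.Exp commutativeSemiring
    using (^-congˡ; ^-congʳ; ^-assocʳ; ^-distrib-*) renaming (_^_ to _^ᴷ_)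
  open import Algebra.Properties.Group +-group using (identityʳ-unique)
  open import Relation.Binary.Reasoning.Setoid setoid

  frob-cong : ∀ {x y} → x ≈ y → frob x ≈ frob y
  frob-cong = ^-congˡ q

  frob-* : ∀ x y → frob (x * y) ≈ frob x * frob y
  frob-* x y = ^-distrib-* x y q

  -- The order q³ is a power of p, so the characteristic is p, and q = p^(k+1) is the exponent of an
  -- iterated p-th power map.
  frob-+ : ∀ x y → frob (x + y) ≈ frob x + frob y
  frob-+ = ≡.subst (λ n → ∀ x y → (x + y) ^ᴷ n ≈ x ^ᴷ n + y ^ᴷ n) (≡.sym q≡p^1+k)
    (Characteristic.[x+y]^p^k prime (suc k ℕ.* 3) q³≡p^[1+k]3 (suc k))
    where
    p k : ℕ
    p = proj₁ primePower
    k = proj₁ (proj₂ primePower)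
    prime : Prime p
    prime = proj₁ (proj₂ (proj₂ primePower))
    q≡p^1+k : q ≡ p ^ suc k
    q≡p^1+k = proj₂ (proj₂ (proj₂ primePower))
    q³≡p^[1+k]3 : q ^ 3 ≡ p ^ (suc k ℕ.* 3)
    q³≡p^[1+k]3 = ≡.trans (≡.cong (_^ 3) q≡p^1+k) (ℕ.^-*-assoc p (suc k) 3)

  frob-0 : frob 0# ≈ 0#
  frob-0 = identityʳ-unique (frob 0#) (frob 0#) (trans (sym (frob-+ 0# 0#)) (frob-cong (+-identityʳ 0#)))

  frob-1 : frob 1# ≈ 1#
  frob-1 = 1^n≈1 q
    where
    1^n≈1 : ∀ n → 1# ^ᴷ n ≈ 1#
    1^n≈1 zero    = refl
    1^n≈1 (suc n) = trans (*-identityˡ _) (1^n≈1 n)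

  frob-sumF : ∀ n (f : Vect n) → frob (sumF n f) ≈ sumF n (frob ∘ f)
  frob-sumF zero    f = frob-0
  frob-sumF (suc n) f = trans (frob-+ _ _) (+-congˡ (frob-sumF n (f ∘ suc)))

  -- The threefold composite is the power map of exponent q³, the order of the field, which fixes
  -- every element.
  frob³ : ∀ x → frob (frob (frob x)) ≈ x
  frob³ x = begin
    frob (frob (frob x))     ≈⟨ ^-assocʳ (frob x) q q ⟩
    frob x ^ᴷ (q ℕ.* q)      ≈⟨ ^-assocʳ x q (q ℕ.* q) ⟩
    x ^ᴷ (q ℕ.* (q ℕ.* q))   ≈⟨ ^-congʳ x (≡.cong (λ n → q ℕ.* (q ℕ.* n)) (≡.sym (ℕ.*-identityʳ q))) ⟩
    x ^ᴷ (q ^ 3)             ≈⟨ x^N≈x x ⟩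
    x                        ∎

  frob^ : ℕ → K → K
  frob^ zero    x = x
  frob^ (suc j) x = frob (frob^ j x)

  frobV^≡frob^ : ∀ j {n} (v : Vect n) k → frobV^ j v k ≡ frob^ j (v k)
  frobV^≡frob^ zero    v k = ≡.refl
  frobV^≡frob^ (suc j) v k = ≡.cong frob (frobV^≡frob^ j v k)

  frob^-* : ∀ j x y → frob^ j (x * y) ≈ frob^ j x * frob^ j y
  frob^-* zero    x y = refl
  frob^-* (suc j) x y = trans (frob-cong (frob^-* j x y)) (frob-* _ _)

  frob^-sumF : ∀ j n (f : Vect n) → frob^ j (sumF n f) ≈ sumF n (frob^ j ∘ f)
  frob^-sumF zero    n f = refl
  frob^-sumF (suc j) n f = trans (frob-cong (frob^-sumF j n f)) (frob-sumF n _)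

  frob^-fixed : ∀ j {x} → InFq x → frob^ j x ≈ x
  frob^-fixed zero    x∈Fq = refl
  frob^-fixed (suc j) x∈Fq = trans (frob-cong (frob^-fixed j x∈Fq)) x∈Fq

  -- Frobenius is semilinear: it conjugates the coefficients along with the vectors.
  frobV^-lincomb : ∀ j {m n} (as : Vect m) (vs : Fin m → Vect n) →
    frobV^ j (lincomb as vs) ≋ lincomb (frob^ j ∘ as) (frobV^ j ∘ vs)
  frobV^-lincomb j {m} as vs k = begin
    frobV^ j (lincomb as vs) k                    ≡⟨ frobV^≡frob^ j (lincomb as vs) k ⟩
    frob^ j (sumF m (λ i → as i * vs i k))        ≈⟨ frob^-sumF j m _ ⟩
    sumF m (λ i → frob^ j (as i * vs i k))        ≈⟨ sumF-cong {m} (λ i → frob^-* j (as i) (vs i k)) ⟩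
    sumF m (λ i → frob^ j (as i) * frob^ j (vs i k))
      ≈⟨ sumF-cong {m} (λ i → *-congˡ (reflexive (frobV^≡frob^ j (vs i) k))) ⟨
    lincomb (frob^ j ∘ as) (frobV^ j ∘ vs) k      ∎

  frobV^-cong : ∀ j {n} {v w : Vect n} → v ≋ w → frobV^ j v ≋ frobV^ j w
  frobV^-cong zero    v≋w = v≋w
  frobV^-cong (suc j) {v = v} v≋w = λ k → frob-cong (frobV^-cong j {v = v} v≋w k)

  inSpan-frobV^ : ∀ j {m n} (vs : Fin m → Vect n) {v} → InSpan vs v → InSpan (frobV^ j ∘ vs) (frobV^ j v)
  inSpan-frobV^ j vs {v} (as , v≋) =
    frob^ j ∘ as , λ k → trans (frobV^-cong j {v = v} v≋ k) (frobV^-lincomb j as vs k)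

  -- Traces and combinations of conjugate vectors.

  trace : K → K
  trace x = sumF 3 (λ t → frob^ (toℕ t) x)

  -- Frobenius permutes the three summands cyclically, the last returning to x by `frob³`.
  trace∈Fq : ∀ x → InFq (trace x)
  trace∈Fq x = begin
    frob (sumF 3 (λ t → frob^ (toℕ t) x))
      ≈⟨ frob-sumF 3 (λ t → frob^ (toℕ t) x) ⟩
    frob x + (frob (frob x) + (frob (frob (frob x)) + 0#))
      ≈⟨ +-congˡ (+-congˡ (trans (+-identityʳ _) (frob³ x))) ⟩
    frob x + (frob (frob x) + x)
      ≈⟨ +-assoc _ _ _ ⟨
    frob x + frob (frob x) + x
      ≈⟨ +-comm _ x ⟩
    x + (frob x + frob (frob x))
      ≈⟨ +-congˡ (+-congˡ (+-identityʳ _)) ⟨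
    trace x ∎

  -- The coordinate action of x ↦ x^q on combinations of v, v^q, v^{q²}.
  shift : Vect 3 → Vect 3
  shift cs zero    = frob (cs (suc (suc zero)))
  shift cs (suc t) = frob (cs (inject₁ t))

  conjugates : ∀ {n} → Vect n → Fin 3 → Vect n
  conjugates v t = frobV^ (toℕ t) v

  -- Frobenius carries each conjugate of v to the next and the third back to v, so every conjugated
  -- coefficient moves one place.
  frob-lincomb-conjugates : ∀ {n} (cs : Vect 3) (v : Vect n) k →
    frob (lincomb cs (conjugates v) k) ≈ lincomb (shift cs) (conjugates v) k
  frob-lincomb-conjugates cs v k = begin
    frob (c₀ * x + (c₁ * frob x + (c₂ * frob (frob x) + 0#)))
      ≈⟨ frob-sumF 3 (λ t → cs t * conjugates v t k) ⟩
    frob (c₀ * x) + (frob (c₁ * frob x) + (frob (c₂ * frob (frob x)) + 0#))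
      ≈⟨ +-cong (frob-* _ _) (+-cong (frob-* _ _) (trans (+-identityʳ _) (trans (frob-* _ _) (*-congˡ (frob³ x))))) ⟩
    frob c₀ * frob x + (frob c₁ * frob (frob x) + frob c₂ * x)
      ≈⟨ +-assoc _ _ _ ⟨
    frob c₀ * frob x + frob c₁ * frob (frob x) + frob c₂ * x
      ≈⟨ +-comm _ _ ⟩
    frob c₂ * x + (frob c₀ * frob x + frob c₁ * frob (frob x))
      ≈⟨ +-congˡ (+-congˡ (+-identityʳ _)) ⟨
    lincomb (shift cs) (conjugates v) k ∎
    where
    x  = v k
    c₀ = cs zero
    c₁ = cs (suc zero)
    c₂ = cs (suc (suc zero))

  -- Matrices over F_q and their inverses.

  idM-diagonal : ∀ i → idM i i ≈ 1#
  idM-diagonal i with i Fin.≟ i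
  ... | yes _   = refl
  ... | no  i≢i = contradiction ≡.refl i≢i

  idM-offDiagonal : ∀ i j → i ≢ j → idM i j ≈ 0#
  idM-offDiagonal i j i≢j with i Fin.≟ j
  ... | yes i≡j = contradiction i≡j i≢j
  ... | no  _   = refl

  idM∈Fq : ∀ i j → InFq (idM i j)
  idM∈Fq i j with i Fin.≟ j
  ... | yes _ = frob-1
  ... | no  _ = frob-0

  columns : Matrix → Fin 9 → Vect 9
  columns M j i = M i j

  applyM≈lincomb : ∀ M v → applyM M v ≋ lincomb v (columns M)
  applyM≈lincomb M v i = sumF-cong {9} (λ j → *-comm (M i j) (v j))

  applyM-cong : ∀ M {v w} → v ≋ w → applyM M v ≋ applyM M w
  applyM-cong M v≋w i = sumF-cong {9} (λ j → *-congˡ {M i j} (v≋w j))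

  applyM-idM : ∀ M k → applyM M (columns idM k) ≋ columns M k
  applyM-idM M k i = begin
    sumF 9 (λ j → M i j * idM j k)
      ≈⟨ sumF-select (λ j → M i j * idM j k) k
           (λ j j≢k → trans (*-congˡ (idM-offDiagonal j k j≢k)) (zeroʳ _)) ⟩
    M i k * idM k k  ≈⟨ *-congˡ (idM-diagonal k) ⟩
    M i k * 1#       ≈⟨ *-identityʳ _ ⟩
    M i k            ∎

  frob-applyM : ∀ {M} → (∀ i j → InFq (M i j)) → ∀ v → frobV (applyM M v) ≋ applyM M (frobV v)
  frob-applyM {M} M∈Fq v i = trans (frob-sumF 9 (λ j → M i j * v j))
    (sumF-cong {9} (λ j → trans (frob-* (M i j) (v j)) (*-congʳ {frob (v j)} (M∈Fq i j))))

  -- Independent columns span, so solving for each column of the identity gives a right inverse N.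
  -- Injectivity of M then yields that N is over F_q and is also a left inverse.
  linIndep⇒FqProjectivity : ∀ M → (∀ i j → InFq (M i j)) → LinIndep (columns M) → FqProjectivity M
  linIndep⇒FqProjectivity M M∈Fq indep = M∈Fq , N , N∈Fq , MN≈1 , NM≈1
    where
    applyM-injective : ∀ {v w} → applyM M v ≋ applyM M w → v ≋ w
    applyM-injective {v} {w} eq = linIndep⇒injective (columns M) indep
      (λ i → trans (sym (applyM≈lincomb M v i)) (trans (eq i) (applyM≈lincomb M w i)))
    solve : ∀ v → InSpan (columns M) v
    solve = linIndep⇒spanning (columns M) indep
    N : Matrix
    N j k = proj₁ (solve (columns idM k)) j
    MN≈1 : ∀ i k → mulM M N i k ≈ idM i k
    MN≈1 i k = trans (applyM≈lincomb M (columns N k) i) (sym (proj₂ (solve (columns idM k)) i))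
    -- M and the identity are fixed by Frobenius, so the conjugate of a column of N solves the same
    -- system as the column itself; the solution is unique.
    N∈Fq : ∀ j k → InFq (N j k)
    N∈Fq j k = applyM-injective {frobV (columns N k)} {columns N k} (λ i → begin
      applyM M (frobV (columns N k)) i  ≈⟨ frob-applyM M∈Fq (columns N k) i ⟨
      frob (mulM M N i k)               ≈⟨ frob-cong (MN≈1 i k) ⟩
      frob (idM i k)                    ≈⟨ idM∈Fq i k ⟩
      idM i k                           ≈⟨ MN≈1 i k ⟨
      applyM M (columns N k) i          ∎) j
    -- M(NM) = (MN)M = M, and M can be cancelled on the left.
    NM≈1 : ∀ j k → mulM N M j k ≈ idM j k
    NM≈1 j k = applyM-injective {columns (mulM N M) k} {columns idM k} (λ i → begin
      applyM M (columns (mulM N M) k) i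
        ≈⟨ sumF-cong {9} (λ l → *-congˡ {M i l} (applyM≈lincomb N (columns M k) l)) ⟩
      applyM M (lincomb (columns M k) (columns N)) i
        ≈⟨ applyM≈lincomb M (lincomb (columns M k) (columns N)) i ⟩
      lincomb (lincomb (columns M k) (columns N)) (columns M) i
        ≈⟨ lincomb-assoc (columns M k) (columns N) (columns M) i ⟨
      lincomb (columns M k) (λ l → lincomb (columns N l) (columns M)) i
        ≈⟨ lincomb-congʳ (columns M k) {λ l → lincomb (columns N l) (columns M)} {columns idM}
             (λ l i → trans (sym (applyM≈lincomb M (columns N l) i)) (MN≈1 i l)) i ⟩
      lincomb (columns M k) (columns idM) i
        ≈⟨ applyM≈lincomb idM (columns M k) i ⟨
      applyM idM (columns M k) i
        ≈⟨ sumF-select (λ j → idM i j * M j k) i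
             (λ j j≢i → trans (*-congʳ (idM-offDiagonal i j (j≢i ∘ ≡.sym))) (zeroˡ _)) ⟩
      idM i i * M i k
        ≈⟨ *-congʳ (idM-diagonal i) ⟩
      1# * M i k
        ≈⟨ *-identityˡ _ ⟩
      M i k
        ≈⟨ applyM-idM M k i ⟨
      applyM M (columns idM k) i ∎) j

  -- The nine conjugates of a basis of Γ.

  quot rem : Fin 9 → Fin 3
  quot s = proj₁ (remQuot {3} 3 s)
  rem  s = proj₂ (remQuot {3} 3 s)

  quot-combine : ∀ (i j : Fin 3) → quot (combine i j) ≡ i
  quot-combine i j = ≡.cong proj₁ (Fin.remQuot-combine {3} {3} i j)

  rem-combine : ∀ (i j : Fin 3) → rem (combine i j) ≡ j
  rem-combine i j = ≡.cong proj₂ (Fin.remQuot-combine {3} {3} i j)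

  -- Here `quot` is the Frobenius exponent and `rem` selects the vector, the order used in
  -- `TransversalPlane`. In `segre`, by contrast, `quot` indexes the first factor.
  allConjugates : (Fin 3 → Vect 9) → Fin 9 → Vect 9
  allConjugates vs s = conjugates (vs (rem s)) (quot s)

  inSpan-allConjugates : ∀ vs t {v} → InSpan vs v → InSpan (allConjugates vs) (conjugates v t)
  inSpan-allConjugates vs t v∈ = inSpan-trans (frobV^ (toℕ t) ∘ vs) (allConjugates vs) member
    (inSpan-frobV^ (toℕ t) vs v∈)
    where
    member : ∀ i → InSpan (allConjugates vs) (conjugates (vs i) t)
    member i = ≡.subst₂ (λ t′ i′ → InSpan (allConjugates vs) (conjugates (vs i′) t′))
      {quot (combine t i)} {t} {rem (combine t i)} {i} (quot-combine t i) (rem-combine t i)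
      (inSpan-member (allConjugates vs) (combine t i))

  -- The rows of coordinates of h with respect to g are independent because h is. Hence they span
  -- K³, and the g-coordinates of v are a combination of them.
  basisOf⇒inSpan : ∀ {g h} → BasisOf g h → ∀ {v} → InSpan g v → InSpan h v
  basisOf⇒inSpan {g} {h} (h⊆g , h-indep) {v} (ds , v≋) = as , λ k → begin
      v k                                             ≈⟨ v≋ k ⟩
      lincomb ds g k                                  ≈⟨ lincomb-congˡ g (proj₂ ds∈) k ⟩
      lincomb (lincomb as coordinates) g k            ≈⟨ comb as k ⟨
      lincomb as h k                                  ∎
    where
    coordinates : Fin 3 → Vect 3
    coordinates i = proj₁ (h⊆g i)
    comb : ∀ as → lincomb as h ≋ lincomb (lincomb as coordinates) g
    comb as k = trans (lincomb-congʳ as {h} {λ i → lincomb (coordinates i) g} (λ i → proj₂ (h⊆g i)) k)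
      (lincomb-assoc as coordinates g k)
    coordinates-indep : LinIndep coordinates
    coordinates-indep as as·A≈0 = h-indep as (λ k → trans (comb as k) (lincomb-zeroˡ g as·A≈0 k))
    ds∈ = linIndep⇒spanning coordinates coordinates-indep ds
    as  = proj₁ ds∈

  -- The conjugates of g span K⁹ and lie in the span of those of h, so the latter are nine spanning
  -- vectors.
  conjugates-linIndep : ∀ {g h} → TransversalPlane g → BasisOf g h → LinIndep (allConjugates h)
  conjugates-linIndep {g} {h} (_ , _ , g-spans) basis = spanning⇒linIndep (allConjugates h) (λ v →
    inSpan-trans (allConjugates g) (allConjugates h)
      (λ s → inSpan-allConjugates h (quot s) {g (rem s)}
               (basisOf⇒inSpan {g} {h} basis {g (rem s)} (inSpan-member g (rem s))))
      (g-spans v))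

  -- The Segre matrix attached to a subplane.

  module Subplane (h : Fin 3 → Vect 9) (H-indep : LinIndep (allConjugates h)) where

    -- Frobenius fixes the coordinates a, so the t-th conjugate of X is the sum of aᵢ times the t-th
    -- conjugate of hᵢ. The coefficients on the nine conjugates thus form the tensor c ⊗ a.
    lincomb-conjugates : ∀ {a} → FqVect a → ∀ cs →
      lincomb cs (conjugates (ptOf h a)) ≋ lincomb (λ s → cs (quot s) * a (rem s)) (allConjugates h)
    lincomb-conjugates {a} a∈Fq cs k = begin
      sumF 3 (λ t → cs t * conjugates (ptOf h a) t k)
        ≈⟨ sumF-cong {3} (λ t → *-congˡ {cs t} (trans (frobV^-lincomb (toℕ t) a h k)
             (sumF-cong {3} (λ i → *-congʳ {conjugates (h i) t k} (frob^-fixed (toℕ t) (a∈Fq i)))))) ⟩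
      sumF 3 (λ t → cs t * sumF 3 (λ i → a i * conjugates (h i) t k))
        ≈⟨ sumF-cong {3} (λ t → trans (*-distribˡ-sumF {3} (cs t) (λ i → a i * conjugates (h i) t k))
             (sumF-cong {3} (λ i → sym (*-assoc (cs t) (a i) (conjugates (h i) t k))))) ⟩
      sumF 3 (λ t → sumF 3 (λ i → cs t * a i * conjugates (h i) t k))
        ≈⟨ sumF-remQuot {3} {3} (λ t i _ → cs t * a i * conjugates (h i) t k) ⟨
      lincomb (λ s → cs (quot s) * a (rem s)) (allConjugates h) k ∎

    -- Independence of the nine conjugates kills all products cₜ aᵢ; a nonzero aᵢ can be cancelled.
    conjugates-ptOf-linIndep : ∀ {a} → FqVect a → NonzeroV a → LinIndep (conjugates (ptOf h a))
    conjugates-ptOf-linIndep {a} a∈Fq (i , aᵢ≉0) cs comb≈0 t = x*y≈0⇒y≈0 aᵢ≉0 (begin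
      a i * cs t                       ≈⟨ *-comm _ _ ⟩
      cs t * a i                       ≡⟨ ≡.cong₂ (λ t′ i′ → cs t′ * a i′) {quot s} {t} {rem s} {i}
                                            (quot-combine t i) (rem-combine t i) ⟨
      cs (quot s) * a (rem s)          ≈⟨ H-indep (λ s → cs (quot s) * a (rem s))
                                            (λ k → trans (sym (lincomb-conjugates a∈Fq cs k)) (comb≈0 k)) s ⟩
      0#                               ∎)
      where s = combine t i

    private
      -- The row (x, x^q, x^{q²}) of a Moore matrix; independence of such rows over K expresses
      -- independence of the scalars over F_q.
      moore : K → Vect 3
      moore x t = frob^ (toℕ t) x

      -- A functional killing the Moore rows of all coordinates of h₀ is a linear relation between
      -- h₀ and its conjugates. These are independent, as h₀ is the point of π with coordinates
      -- (1,0,0).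
      h₀-linIndep : ∀ φ → (∀ k → sumF 3 (λ t → φ t * moore (h zero k) t) ≈ 0#) → ∀ t → φ t ≈ 0#
      h₀-linIndep φ φh₀≈0 = conjugates-ptOf-linIndep {a = δ} δ∈Fq (zero , proj₁ isField) φ (λ k →
        trans (lincomb-congʳ φ {conjugates (ptOf h δ)} {conjugates (h zero)} (λ t → X≋h₀ (toℕ t)) k)
        (trans (sumF-cong {3} (λ t → *-congˡ {φ t} (reflexive (frobV^≡frob^ (toℕ t) (h zero) k)))) (φh₀≈0 k)))
        where
        δ : Vect 3
        δ zero    = 1#
        δ (suc _) = 0#
        δ∈Fq : FqVect δ
        δ∈Fq zero    = frob-1
        δ∈Fq (suc _) = frob-0
        X≋h₀ : ∀ j → frobV^ j (ptOf h δ) ≋ frobV^ j (h zero)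
        X≋h₀ j = frobV^-cong j {v = ptOf h δ} {w = h zero} (λ k → trans
          (sumF-select (λ i → δ i * h i k) zero
            (λ { zero 0≢0 → contradiction ≡.refl 0≢0 ; (suc i) _ → zeroˡ _ }))
          (*-identityˡ _))

      -- This lets an F_q-basis of K be picked among the nine coordinates of h₀: a finite search
      -- finds one whose Moore row is not killed by φ.
      total : ∀ φ → ¬ (∀ t → φ t ≈ 0#) →
              ∃ λ k → ¬ sumF 3 (λ t → φ t * moore (h zero k) t) ≈ 0#
      total φ φ≉0 = Fin.¬∀⟶∃¬ 9 _ (λ k → sumF 3 (λ t → φ t * moore (h zero k) t) ≈? 0#)
                      (φ≉0 ∘ h₀-linIndep φ)

      chosen = independent-subfamily (moore ∘ h zero) total 3 ℕ.≤-refl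

    -- moore-linIndep makes e an F_q-basis of K.
    e : Fin 3 → K
    e j = h zero (proj₁ chosen j)

    moore-linIndep : LinIndep (moore ∘ e)
    moore-linIndep = proj₂ chosen

    segreMatrix : Matrix
    segreMatrix k s = trace (e (rem s) * h (quot s) k)

    -- The factorization of M into the matrix of conjugates and copies of the Moore matrix: each
    -- trace is expanded over t, and the terms belonging to the same conjugate of hᵢ are collected.
    applyM-segreMatrix : ∀ B → applyM segreMatrix B ≋
      lincomb (λ s → sumF 3 (λ j → B (combine (rem s) j) * moore (e j) (quot s))) (allConjugates h)
    applyM-segreMatrix B k = begin
      sumF 9 (λ s → trace (e (rem s) * h (quot s) k) * B s)
        ≈⟨ sumF-remQuot {3} {3} (λ i j s → trace (e j * h i k) * B s) ⟩
      sumF 3 (λ i → sumF 3 (λ j → trace (e j * h i k) * B (combine i j)))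
        ≈⟨ sumF-cong {3} (λ i → sumF-cong {3} (λ j → trans
             (*-distribʳ-sumF {3} (λ t → frob^ (toℕ t) (e j * h i k)) (B (combine i j)))
             (sumF-cong {3} (λ t → term t i j)))) ⟩
      sumF 3 (λ i → sumF 3 (λ j → sumF 3 (λ t → T t i j)))
        ≈⟨ sumF-cong {3} (λ i → sumF-comm {3} {3} (λ j t → T t i j)) ⟩
      sumF 3 (λ i → sumF 3 (λ t → sumF 3 (λ j → T t i j)))
        ≈⟨ sumF-comm {3} {3} (λ i t → sumF 3 (λ j → T t i j)) ⟩
      sumF 3 (λ t → sumF 3 (λ i → sumF 3 (λ j → T t i j)))
        ≈⟨ sumF-cong {3} (λ t → sumF-cong {3} (λ i →
             *-distribʳ-sumF {3} (λ j → B (combine i j) * moore (e j) t) (conjugates (h i) t k))) ⟨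
      sumF 3 (λ t → sumF 3 (λ i → sumF 3 (λ j → B (combine i j) * moore (e j) t) * conjugates (h i) t k))
        ≈⟨ sumF-remQuot {3} {3} (λ t i _ →
             sumF 3 (λ j → B (combine i j) * moore (e j) t) * conjugates (h i) t k) ⟨
      lincomb (λ s → sumF 3 (λ j → B (combine (rem s) j) * moore (e j) (quot s))) (allConjugates h) k ∎
      where
      T : Fin 3 → Fin 3 → Fin 3 → K
      T t i j = B (combine i j) * moore (e j) t * conjugates (h i) t k
      term : ∀ t i j → frob^ (toℕ t) (e j * h i k) * B (combine i j) ≈ T t i j
      term t i j = begin
        frob^ (toℕ t) (e j * h i k) * B (combine i j)
          ≈⟨ *-comm _ _ ⟩
        B (combine i j) * frob^ (toℕ t) (e j * h i k)
          ≈⟨ *-congˡ (frob^-* (toℕ t) (e j) (h i k)) ⟩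
        B (combine i j) * (moore (e j) t * frob^ (toℕ t) (h i k))
          ≈⟨ *-assoc _ _ _ ⟨
        B (combine i j) * moore (e j) t * frob^ (toℕ t) (h i k)
          ≡⟨ ≡.cong (B (combine i j) * moore (e j) t *_) (frobV^≡frob^ (toℕ t) (h i) k) ⟨
        T t i j ∎

    -- Independence of the nine conjugates makes every collected coefficient vanish. For fixed i
    -- these are, as t varies, a relation between Moore rows with coefficients the i-th row of B.
    segreMatrix-linIndep : LinIndep (columns segreMatrix)
    segreMatrix-linIndep B comb≈0 s = ≡.subst (λ s → B s ≈ 0#) (Fin.combine-remQuot {3} 3 s)
      (moore-linIndep (λ j → B (combine (quot s) j)) (λ t → begin
        coeff t (quot s)
          ≡⟨ ≡.cong₂ coeff {quot (combine t (quot s))} {t} {rem (combine t (quot s))} {quot s}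
               (quot-combine t (quot s)) (rem-combine t (quot s)) ⟨
        coeff (quot (combine t (quot s))) (rem (combine t (quot s)))
          ≈⟨ H-indep (λ s → coeff (quot s) (rem s)) (λ k → trans (sym (applyM-segreMatrix B k))
               (trans (applyM≈lincomb segreMatrix B k) (comb≈0 k))) (combine t (quot s)) ⟩
        0# ∎) (rem s))
      where
      coeff : Fin 3 → Fin 3 → K
      coeff t i = sumF 3 (λ j → B (combine i j) * moore (e j) t)

    segreMatrix-projectivity : FqProjectivity segreMatrix
    segreMatrix-projectivity =
      linIndep⇒FqProjectivity segreMatrix (λ _ _ → trace∈Fq _) segreMatrix-linIndep

    -- M (a ⊗ b) = Tr (x X) for X = Σ aᵢ hᵢ and x = Σ bⱼ eⱼ; the hypothesis is
    -- the latter equation together with its conjugates.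
    applyM-segre : ∀ {a} → FqVect a → ∀ b x → moore x ≋ lincomb b (moore ∘ e) →
      applyM segreMatrix (segre a b) ≋ lincomb (moore x) (conjugates (ptOf h a))
    applyM-segre {a} a∈Fq b x x≋ k = begin
      applyM segreMatrix (segre a b) k
        ≈⟨ applyM-segreMatrix (segre a b) k ⟩
      lincomb (λ s → sumF 3 (λ j → segre a b (combine (rem s) j) * moore (e j) (quot s))) (allConjugates h) k
        ≈⟨ lincomb-congˡ (allConjugates h)
             {λ s → sumF 3 (λ j → segre a b (combine (rem s) j) * moore (e j) (quot s))}
             {λ s → moore x (quot s) * a (rem s)} coefficient k ⟩
      lincomb (λ s → moore x (quot s) * a (rem s)) (allConjugates h) k
        ≈⟨ lincomb-conjugates a∈Fq (moore x) k ⟨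
      lincomb (moore x) (conjugates (ptOf h a)) k ∎
      where
      coefficient : ∀ s → sumF 3 (λ j → segre a b (combine (rem s) j) * moore (e j) (quot s)) ≈
                          moore x (quot s) * a (rem s)
      coefficient s = begin
        sumF 3 (λ j → segre a b (combine i j) * moore (e j) t)
          ≈⟨ sumF-cong {3} (λ j → *-congʳ {moore (e j) t} (reflexive
               (≡.cong₂ (λ i′ j′ → a i′ * b j′) {quot (combine i j)} {i} {rem (combine i j)} {j}
                 (quot-combine i j) (rem-combine i j)))) ⟩
        sumF 3 (λ j → a i * b j * moore (e j) t)
          ≈⟨ sumF-cong {3} (λ j → *-assoc (a i) (b j) (moore (e j) t)) ⟩
        sumF 3 (λ j → a i * (b j * moore (e j) t))
          ≈⟨ *-distribˡ-sumF {3} (a i) (λ j → b j * moore (e j) t) ⟨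
        a i * lincomb b (moore ∘ e) t
          ≈⟨ *-congˡ (x≋ t) ⟨
        a i * moore x t
          ≈⟨ *-comm _ _ ⟩
        moore x t * a i ∎
        where
        t = quot s
        i = rem s

    -- Spread planes compared with the planes of the Segre variety.

    -- Frobenius permutes the three equations cyclically and replaces b by its conjugate; uniqueness
    -- of the solution gives equality.
    coordinates∈Fq : ∀ x b → moore x ≋ lincomb b (moore ∘ e) → FqVect b
    coordinates∈Fq x b x≋ = linIndep⇒injective (moore ∘ e) moore-linIndep {frobV b} {b}
      (λ t → trans (sym (step t)) (x≋ t))
      where
      frob-coords : ∀ t {y} → y ≈ lincomb b (moore ∘ e) t →
                    frob y ≈ sumF 3 (λ j → frob (b j) * frob (moore (e j) t))
      frob-coords t y≈ = trans (frob-cong y≈) (trans (frob-sumF 3 (λ j → b j * moore (e j) t))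
        (sumF-cong {3} (λ j → frob-* (b j) (moore (e j) t))))
      step : ∀ t → moore x t ≈ lincomb (frobV b) (moore ∘ e) t
      -- The cycle closes here: conjugating the equation for exponent 2 gives the one for exponent
      -- 0, by `frob³`.
      step zero = trans (sym (frob³ x)) (trans (frob-coords (suc (suc zero)) (x≋ (suc (suc zero))))
        (sumF-cong {3} (λ j → *-congˡ {frob (b j)} (frob³ (e j)))))
      step (suc zero)       = frob-coords zero (x≋ zero)
      step (suc (suc zero)) = frob-coords (suc zero) (x≋ (suc zero))

    -- Since w is its own conjugate and its coefficients are unique, they agree with their shift.
    -- Hence w is the trace of c₀ X.
    rational⇒trace : ∀ {a w} → FqVect a → NonzeroV a → FqVect w → ∀ cs →
      w ≋ lincomb cs (conjugates (ptOf h a)) → cs ≋ moore (cs zero)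
    rational⇒trace {a} {w} a∈Fq a≉0 w∈Fq cs w≋ =
      λ { zero             → refl
        ; (suc zero)       → c≋shift (suc zero)
        ; (suc (suc zero)) → trans (c≋shift (suc (suc zero))) (frob-cong (c≋shift (suc zero))) }
      where
      c≋shift : cs ≋ shift cs
      c≋shift = linIndep⇒injective (conjugates (ptOf h a)) (conjugates-ptOf-linIndep a∈Fq a≉0) (λ k → begin
        lincomb cs (conjugates (ptOf h a)) k          ≈⟨ w≋ k ⟨
        w k                                           ≈⟨ w∈Fq k ⟨
        frob (w k)                                    ≈⟨ frob-cong (w≋ k) ⟩
        frob (lincomb cs (conjugates (ptOf h a)) k)   ≈⟨ frob-lincomb-conjugates cs (ptOf h a) k ⟩
        lincomb (shift cs) (conjugates (ptOf h a)) k  ∎)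

    -- Dividing by the scalar s reduces v to its F_q-representative w, which is the trace of x X for
    -- some x; the coordinates b of x give the second Segre factor.
    bracket⇒segrePlane : ∀ {a} → FqVect a → NonzeroV a → ∀ v →
                         Bracket (ptOf h a) v → SegrePlane₂ segreMatrix a v
    bracket⇒segrePlane {a} a∈Fq a≉0 v ((v≉0 , s , w , w∈Fq , v≋sw) , cs , v≋) =
      v≉0 , s , b , coordinates∈Fq x b x≋ , λ k → trans (v≋sw k) (*-congˡ (begin
        w k                                          ≈⟨ w≋ k ⟩
        lincomb ds (conjugates (ptOf h a)) k
          ≈⟨ lincomb-congˡ (conjugates (ptOf h a)) {ds} {moore x} (rational⇒trace a∈Fq a≉0 w∈Fq ds w≋) k ⟩
        lincomb (moore x) (conjugates (ptOf h a)) k  ≈⟨ applyM-segre a∈Fq b x x≋ k ⟨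
        applyM segreMatrix (segre a b) k             ∎))
      where
      s≉0 : ¬ s ≈ 0#
      s≉0 s≈0 = proj₂ v≉0 (trans (v≋sw _) (trans (*-congʳ s≈0) (zeroˡ _)))
      s⁻¹ = proj₁ (proj₂ isField s s≉0)
      ds : Vect 3
      ds t = s⁻¹ * cs t
      w≋ : w ≋ lincomb ds (conjugates (ptOf h a))
      w≋ k = begin
        w k                                              ≈⟨ *-identityˡ _ ⟨
        1# * w k                                         ≈⟨ *-congʳ (trans (*-comm _ _) (proj₂ (proj₂ isField s s≉0))) ⟨
        s⁻¹ * s * w k                                    ≈⟨ *-assoc _ _ _ ⟩
        s⁻¹ * (s * w k)                                  ≈⟨ *-congˡ (trans (sym (v≋sw k)) (v≋ k)) ⟩
        s⁻¹ * lincomb cs (conjugates (ptOf h a)) k       ≈⟨ *-distribˡ-sumF {3} s⁻¹ (λ t → cs t * conjugates (ptOf h a) t k) ⟩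
        sumF 3 (λ t → s⁻¹ * (cs t * conjugates (ptOf h a) t k))
          ≈⟨ sumF-cong {3} (λ t → *-assoc s⁻¹ (cs t) (conjugates (ptOf h a) t k)) ⟨
        lincomb ds (conjugates (ptOf h a)) k             ∎
      x = ds zero
      -- The coordinates of x are first found over K from all three conjugate equations;
      -- `coordinates∈Fq` then places them in F_q.
      solution = linIndep⇒spanning (moore ∘ e) moore-linIndep (moore x)
      b = proj₁ solution
      x≋ = proj₂ solution

    segrePlane⇒bracket : ∀ {a} → FqVect a → ∀ v → SegrePlane₂ segreMatrix a v → Bracket (ptOf h a) v
    segrePlane⇒bracket {a} a∈Fq v (v≉0 , s , b , b∈Fq , v≋) =
      (v≉0 , s , w , w∈Fq , v≋) , (λ t → s * moore x t) , λ k → begin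
        v k                                              ≈⟨ v≋ k ⟩
        s * w k                                          ≈⟨ *-congˡ (applyM-segre a∈Fq b x x≋ k) ⟩
        s * lincomb (moore x) (conjugates (ptOf h a)) k  ≈⟨ *-distribˡ-sumF {3} s (λ t → moore x t * conjugates (ptOf h a) t k) ⟩
        sumF 3 (λ t → s * (moore x t * conjugates (ptOf h a) t k))
          ≈⟨ sumF-cong {3} (λ t → *-assoc s (moore x t) (conjugates (ptOf h a) t k)) ⟨
        lincomb (λ t → s * moore x t) (conjugates (ptOf h a)) k ∎
      where
      w = applyM segreMatrix (segre a b)
      w∈Fq : FqVect w
      w∈Fq k = trans (frob-applyM {segreMatrix} (λ _ _ → trace∈Fq _) (segre a b) k)
        (applyM-cong segreMatrix {frobV (segre a b)} {segre a b}
          (λ s → trans (frob-* _ _) (*-cong (a∈Fq (quot s)) (b∈Fq (rem s)))) k)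
      -- The scalar with coordinates b; its conjugate equations hold because b is over F_q.
      x = sumF 3 (λ j → b j * e j)
      x≋ : moore x ≋ lincomb b (moore ∘ e)
      x≋ t = trans (frob^-sumF (toℕ t) 3 (λ j → b j * e j)) (sumF-cong {3} (λ j →
        trans (frob^-* (toℕ t) (b j) (e j)) (*-congʳ {moore (e j) t} (frob^-fixed (toℕ t) (b∈Fq j)))))

    -- The correspondence is the identity on a: the coordinates of X in π are the fixed first factor
    -- of its Segre plane.
    sameFamily : SameFamily h (SegrePlane₂ segreMatrix)
    sameFamily = (λ a a∈Fq a≉0 → a , a∈Fq , a≉0 , bracket⇔segrePlane a∈Fq a≉0)
               , (λ a a∈Fq a≉0 → a , a∈Fq , a≉0 , bracket⇔segrePlane a∈Fq a≉0)
      where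
      bracket⇔segrePlane : ∀ {a} → FqVect a → NonzeroV a →
                           ∀ v → Bracket (ptOf h a) v ⇔ SegrePlane₂ segreMatrix a v
      bracket⇔segrePlane a∈Fq a≉0 v = mk⇔ (bracket⇒segrePlane a∈Fq a≉0 v) (segrePlane⇒bracket a∈Fq v)

theorem6p1 : ∀ {c ℓ} (R : CommutativeRing c ℓ) (q : ℕ)
    → IsPrimePower q → IsField R → HasCard R (q ^ 3)
    → (g h : Fin 3 → Geometry.Vect R q 9)
    → Geometry.TransversalPlane R q g
    → Geometry.BasisOf R q g h
    → Geometry.OneSystemOfSegre R q h
theorem6p1 R q primePower isField card g h transversal basis =
  segreMatrix , segreMatrix-projectivity , inj₂ sameFamily
  where
  open CubicExtension R q primePower isField card
  open Subplane h (conjugates-linIndep {g} transversal basis)
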